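{- For every integer $k\geq 3$ there exists an integer $n_k$ such that for every admissible integer $n\geq n_k$ there exists a $k$-chromatic $P_4$ system of order $n$.
   Context: $P_4=(a_1,a_2,a_3,a_4)$ denotes the path on four distinct vertices with edges $\{a_1,a_2\},\{a_2,a_3\},\{a_3,a_4\}$. A $P_4$ system of order $n$ is a pair $(V,\mathcal B)$ where $|V|=n$ and $\mathcal B$ is a set of $P_4$ paths with vertices in $V$ whose edge sets partition the edge set of the complete graph on $V$. An integer $n$ is admissible (for $P_4$) if $n=1$, or $n\geq 4$ and $n(n-1)\equiv 0\pmod 6$ (equivalently, $n \geq 4$ and $n\equiv 0,1\pmod 3$). A $k$-colouring of $(V,\mathcal B)$ is a partition of $V$ into $k$ (possibly empty) colour classes such that no path in $\mathcal B$ is monochromatic. The system is $k$-colourable if it has a $k$-colouring, and $k$-chromatic if it is $k$-colourable but not $(k-1)$-colourable. -}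

module Defs where

open import Data.Fin.Base using (Fin)
open import Data.List.Base using (List; []; _∷_; length; lookup)
open import Data.List.Relation.Unary.All using (All)
open import Data.List.Relation.Unary.Unique.Propositional using (Unique)
open import Data.Nat.Base using (ℕ; _*_; _∸_; _≤_; _%_)
open import Data.Product.Base using (Σ-syntax; ∃-syntax; _×_)
open import Data.Product using (∃!)
open import Data.Sum.Base using (_⊎_)
open import Relation.Binary.PropositionalEquality.Core using (_≡_; _≢_)
open import Relation.Nullary.Negation.Core using (¬_)

record P₄ (V : Set) : Set where
  constructor path
  field
    a₁ a₂ a₃ a₄ : V
    distinct    : Unique (a₁ ∷ a₂ ∷ a₃ ∷ a₄ ∷ [])

-- Equality of the unordered pairs {u, v} and {a, b}.
SamePair : {V : Set} → V → V → V → V → Set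
SamePair u v a b = (u ≡ a × v ≡ b) ⊎ (u ≡ b × v ≡ a)

HasEdge : {V : Set} → P₄ V → V → V → Set
HasEdge p u v = SamePair u v a₁ a₂ ⊎ SamePair u v a₂ a₃ ⊎ SamePair u v a₃ a₄
  where open P₄ p

-- The vertex set is Fin n.  Uniqueness in `partition` is of the position in
-- the list, so no path can be listed twice, nor together with its reversal:
-- the list represents a set of paths with pairwise disjoint edge sets.
record P₄System (n : ℕ) : Set where
  field
    blocks    : List (P₄ (Fin n))
    partition : ∀ (u v : Fin n) → u ≢ v →
                ∃! _≡_ λ (i : Fin (length blocks)) → HasEdge (lookup blocks i) u v

-- Partitions of V into k possibly empty classes are maps V → Fin k.
Monochromatic : {V : Set} {k : ℕ} → (V → Fin k) → P₄ V → Set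
Monochromatic c p = ∃[ x ] (c a₁ ≡ x × c a₂ ≡ x × c a₃ ≡ x × c a₄ ≡ x)
  where open P₄ p

IsColouring : {n : ℕ} → P₄System n → (k : ℕ) → (Fin n → Fin k) → Set
IsColouring S k c = All (λ p → ¬ Monochromatic c p) (P₄System.blocks S)

Colourable : {n : ℕ} → P₄System n → ℕ → Set
Colourable {n} S k = Σ[ c ∈ (Fin n → Fin k) ] IsColouring S k c

-- Meaningful for k ≥ 1 only, since ∸ truncates.
Chromatic : {n : ℕ} → P₄System n → ℕ → Set
Chromatic S k = Colourable S k × ¬ Colourable S (k ∸ 1)

Admissible : ℕ → Set
Admissible n = n ≡ 1 ⊎ (4 ≤ n × (n * (n ∸ 1)) % 6 ≡ 0)

{-# OPTIONS --safe #-}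
module Submission where

open import Defs
open import Data.Bool.Base using (Bool; true; false)
open import Data.Empty using (⊥-elim)
open import Data.Fin.Base using (Fin; zero; suc; toℕ; fromℕ; inject₁; finToFun; funToFin; punchOut; _↑ˡ_; splitAt; _<_)
open import Data.Fin.Patterns using (0F; 1F; 2F; 3F; 4F; 5F)
open import Data.Fin.Properties using (_≟_; any?; all?; _<?_; <-cmp; <-asym; <⇒≢; 1↔⊤; 2↔Bool; +↔⊎; *↔×; finToFun-funToFin; fromℕ≢inject₁; inject₁-injective; punchIn-punchOut; punchOut-injective; splitAt-↑ˡ; suc-injective; toℕ-inject₁; ↑ˡ-injective)
open import Data.List.Base using (List; []; _∷_; _++_; map; concat; tabulate; length; lookup)
import Data.List.Membership.DecPropositional as DecMembership
open import Data.List.Membership.Propositional using (_∈_)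
open import Data.List.Membership.Propositional.Properties using (∈-lookup)
open import Data.List.Relation.Unary.All as All using (All; []; _∷_)
import Data.List.Relation.Unary.All.Properties as All
open import Data.List.Relation.Unary.AllPairs using ([]; _∷_)
import Data.List.Relation.Unary.Unique.DecPropositional as DecUnique
import Data.List.Relation.Unary.Unique.Propositional.Properties as Unique
open import Data.Nat.Base as ℕ using (ℕ; zero; suc; _+_; _*_; _∸_; _^_; _≥_; _%_; _/_; s≤s; z≤n)
open import Data.Nat.DivMod using (m≡m%n+[m/n]*n; m%n<n)
open import Data.Nat.Divisibility using (_∣_; _∣?_; ∣-trans; ∣m+n∣m⇒∣n; n∣m*n; m%n≡0⇒n∣m)
import Data.Nat.Properties as ℕ
open import Data.Nat.Tactic.RingSolver using (solve-∀)
open import Data.Product using (∃!)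
open import Data.Product.Base using (Σ-syntax; ∃; ∃-syntax; ∃₂; _×_; _,_; proj₁; proj₂)
open import Data.Product.Function.NonDependent.Propositional using (_×-↔_)
open import Data.Product.Properties using (,-injectiveˡ)
open import Data.Sum.Base using (_⊎_; inj₁; inj₂; [_,_]) renaming (map to map-⊎; map₂ to map-⊎₂)
open import Data.Sum.Function.Propositional using (_⊎-↔_)
import Data.Sum.Properties as Sum
open import Data.Sum.Properties using (inj₁-injective; inj₂-injective)
open import Data.Unit.Base using (⊤; tt)
open import Function.Base using (_∘_; id)
open import Function.Bundles using (_↔_; Inverse; Injection)
open import Function.Definitions using (Injective)
open import Function.Properties.Inverse using (↔-refl; ↔-sym; ↔-trans; ↔⇒↣)
open import Relation.Binary.Definitions using (DecidableEquality; tri<; tri≈; tri>)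
open import Relation.Binary.PropositionalEquality using (_≡_; _≢_; refl; sym; trans; cong; subst; subst₂; ≢-sym)
open import Relation.Nullary.Decidable using (Dec; yes; no; ¬?; does; map′; decidable-stable; from-yes; from-no; True; toWitness; _×-dec_; _⊎-dec_; _→-dec_)
open import Relation.Nullary.Negation.Core using (¬_; contradiction)

open Inverse using (to; from; strictlyInverseˡ; strictlyInverseʳ)

-- A packing is a set of edge-disjoint paths that need not cover every edge.
-- Packings that are (k+1)-colourable but not k-colourable are built by
-- induction on k.  Take a base set so large that each of its (k+1)-colourings
-- has many vertices of one colour; for each such colouring f attach two copies
-- of the previous packing, and for each w in the first and w′ in the second a
-- path w, t, w′, t′, where t and t′ are base vertices used for this pair only
-- and f gives all these base vertices one colour.  If the base is coloured by
-- f, one of the two copies avoids this colour, hence is coloured by k colours.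
--
-- To complete a packing, replace each vertex u by a triple (u , i) whose
-- colours are three distinct shifts of the colour of u.  A path with two
-- vertices in one triple is never monochromatic.  Between two triples there is
-- a K₃,₃, which is three such paths; if the packing covers the pair, there are
-- the three parallel copies of its path and a hexagon, which is two such paths.
-- What remains are the triangles inside the triples: a hub of 1 or 6 further
-- vertices, joined to every triple, absorbs them and fixes the order modulo 3.

-- Finite types.

Finite : Set → Set
Finite A = Σ[ n ∈ ℕ ] A ↔ Fin n

fin : ∀ {n} → Finite (Fin n)
fin = _ , ↔-refl

infixr 1 _⊎-fin_
infixr 2 _×-fin_

_⊎-fin_ : ∀ {A B} → Finite A → Finite B → Finite (A ⊎ B)
(_ , e) ⊎-fin (_ , e′) = _ , ↔-trans (e ⊎-↔ e′) (↔-sym +↔⊎)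

_×-fin_ : ∀ {A B} → Finite A → Finite B → Finite (A × B)
(_ , e) ×-fin (_ , e′) = _ , ↔-trans (e ×-↔ e′) (↔-sym *↔×)

bool-fin : Finite Bool
bool-fin = 2 , ↔-sym 2↔Bool

exists? : ∀ {A} → Finite A → {P : A → Set} → (∀ a → Dec (P a)) → Dec (∃ P)
exists? (_ , e) {P} P? = map′ (λ (i , p) → from e i , p)
  (λ (a , p) → to e a , subst P (sym (strictlyInverseʳ e a)) p) (any? (P? ∘ from e))

to-injective : ∀ {A B : Set} (e : A ↔ B) → Injective _≡_ _≡_ (to e)
to-injective e = Injection.injective (↔⇒↣ e)

from-injective : ∀ {A B : Set} (e : A ↔ B) → Injective _≡_ _≡_ (from e)
from-injective e = to-injective (↔-sym e)

-- A pigeonhole principle for colourings.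

-- A power of `Q` rather than a set of the least size that counting allows: the first coordinate
-- cuts it into layers, so induction on the number of colours replaces counting.
Tower : Set → ℕ → Set
Tower Q zero    = ⊤
Tower Q (suc k) = Q × Tower Q k

tower-fin : ∀ {Q} → Finite Q → ∀ k → Finite (Tower Q k)
tower-fin Q-fin zero    = 1 , ↔-sym 1↔⊤
tower-fin Q-fin (suc k) = Q-fin ×-fin tower-fin Q-fin k

-- Either every layer {q} × Tower Q k meets the colour 0, or some layer omits it.
monochromatic-embedding : ∀ {Q} → Finite Q → ∀ k (f : Tower Q k → Fin k) →
  ∃[ c ] Σ[ t ∈ (Q → Tower Q k) ] Injective _≡_ _≡_ t × (∀ q → f (t q) ≡ c)
monochromatic-embedding Q-fin zero f with () ← f tt
monochromatic-embedding {Q} Q-fin (suc k) f = by-layers (exists? Q-fin (¬? ∘ meets?))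
  where
  meets? : ∀ q → Dec (∃[ x ] f (q , x) ≡ zero)
  meets? q = exists? (tower-fin Q-fin k) (λ x → f (q , x) ≟ zero)

  by-layers : Dec (∃[ q ] ¬ (∃[ x ] f (q , x) ≡ zero)) →
    ∃[ c ] Σ[ t ∈ (Q → Tower Q (suc k)) ] Injective _≡_ _≡_ t × (∀ q → f (t q) ≡ c)
  by-layers (yes (q , omits)) =
    let f≢0 x = λ 0≡f → omits (x , sym 0≡f)
        (c , t , t-inj , mono) = monochromatic-embedding Q-fin k (λ x → punchOut (f≢0 x))
    in suc c , (λ q′ → q , t q′) , t-inj ∘ cong proj₂ ,
       (λ q′ → trans (sym (punchIn-punchOut (f≢0 (t q′)))) (cong suc (mono q′)))
  by-layers (no ¬omits) =
    let meets q = decidable-stable (meets? q) (λ ¬meets → ¬omits (q , ¬meets))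
    in zero , (λ q → q , proj₁ (meets q)) , cong proj₁ , (λ q → proj₂ (meets q))

-- Paths and packings under injections.

-- Colourings pull back by computation: `Monochromatic c (map-path f f-inj p)` unfolds to
-- `Monochromatic (c ∘ f) p`, which later proofs use silently.
map-path : {A B : Set} (f : A → B) → Injective _≡_ _≡_ f → P₄ A → P₄ B
map-path f f-inj (path a b c d distinct) = path (f a) (f b) (f c) (f d) (Unique.map⁺ f-inj distinct)

module _ {A B : Set} (f : A → B) (f-inj : Injective _≡_ _≡_ f) where

  edge-map⁺ : ∀ p {a b} → HasEdge p a b → HasEdge (map-path f f-inj p) (f a) (f b)
  edge-map⁺ p (inj₁ (inj₁ (refl , refl)))        = inj₁ (inj₁ (refl , refl))
  edge-map⁺ p (inj₁ (inj₂ (refl , refl)))        = inj₁ (inj₂ (refl , refl))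
  edge-map⁺ p (inj₂ (inj₁ (inj₁ (refl , refl)))) = inj₂ (inj₁ (inj₁ (refl , refl)))
  edge-map⁺ p (inj₂ (inj₁ (inj₂ (refl , refl)))) = inj₂ (inj₁ (inj₂ (refl , refl)))
  edge-map⁺ p (inj₂ (inj₂ (inj₁ (refl , refl)))) = inj₂ (inj₂ (inj₁ (refl , refl)))
  edge-map⁺ p (inj₂ (inj₂ (inj₂ (refl , refl)))) = inj₂ (inj₂ (inj₂ (refl , refl)))

  edge-map⁻ : ∀ p {x y} → HasEdge (map-path f f-inj p) x y →
    ∃₂ λ a b → x ≡ f a × y ≡ f b × HasEdge p a b
  edge-map⁻ p (inj₁ (inj₁ (refl , refl)))        = _ , _ , refl , refl , inj₁ (inj₁ (refl , refl))
  edge-map⁻ p (inj₁ (inj₂ (refl , refl)))        = _ , _ , refl , refl , inj₁ (inj₂ (refl , refl))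
  edge-map⁻ p (inj₂ (inj₁ (inj₁ (refl , refl)))) = _ , _ , refl , refl , inj₂ (inj₁ (inj₁ (refl , refl)))
  edge-map⁻ p (inj₂ (inj₁ (inj₂ (refl , refl)))) = _ , _ , refl , refl , inj₂ (inj₁ (inj₂ (refl , refl)))
  edge-map⁻ p (inj₂ (inj₂ (inj₁ (refl , refl)))) = _ , _ , refl , refl , inj₂ (inj₂ (inj₁ (refl , refl)))
  edge-map⁻ p (inj₂ (inj₂ (inj₂ (refl , refl)))) = _ , _ , refl , refl , inj₂ (inj₂ (inj₂ (refl , refl)))

-- Being monochromatic depends only on which vertices share a colour, so this serves for deleting,
-- shifting and embedding colours alike.
monochromatic-transfer : ∀ {V k l} (c : V → Fin k) (d : V → Fin l) →
  (∀ u v → c u ≡ c v → d u ≡ d v) → ∀ p → Monochromatic c p → Monochromatic d p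
monochromatic-transfer c d c⇒d p (_ , e₁ , e₂ , e₃ , e₄) =
  _ , refl , c⇒d _ _ (trans e₂ (sym e₁)) , c⇒d _ _ (trans e₃ (sym e₁)) , c⇒d _ _ (trans e₄ (sym e₁))

record Packing (V I : Set) : Set where
  field
    paths    : I → P₄ V
    disjoint : ∀ {i j u v} → HasEdge (paths i) u v → HasEdge (paths j) u v → i ≡ j

open Packing

IsPackingColouring : ∀ {V I k} → Packing V I → (V → Fin k) → Set
IsPackingColouring P c = ∀ i → ¬ Monochromatic c (paths P i)

PackingColourable : ∀ {V I} → Packing V I → ℕ → Set
PackingColourable {V} P k = Σ[ c ∈ (V → Fin k) ] IsPackingColouring P c

map-packing : ∀ {V W I J} (f : V → W) → Injective _≡_ _≡_ f → (g : J → I) → Injective _≡_ _≡_ g → Packing V I → Packing W J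
map-packing f f-inj g g-inj P .paths    = map-path f f-inj ∘ paths P ∘ g
map-packing f f-inj g g-inj P .disjoint {i} {j} e e′
  with _ , _ , refl , refl , p  ← edge-map⁻ f f-inj (paths P (g i)) e
     | _ , _ , u≡ , v≡ , p′ ← edge-map⁻ f f-inj (paths P (g j)) e′
  = g-inj (disjoint P p (subst₂ (HasEdge (paths P (g j))) (sym (f-inj u≡)) (sym (f-inj v≡)) p′))

-- The base of the induction step.

-- The slots to be filled by base vertices for one code: for each pair (w, w′), `false` stands for t
-- and `true` for t′ on the path w, t, w′, t′.
Anchor : ℕ → Set
Anchor m = Bool × Fin m × Fin m

anchor-fin : ∀ {m} → Finite (Anchor m)
anchor-fin = bool-fin ×-fin fin ×-fin fin

-- All that the induction step needs of the base. Injectivity of `anchor f` keeps the linking paths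
-- edge-disjoint; `monochromatic` supplies the colour that they expel from one of the two copies.
record Anchoring (k : ℕ) (Q : Set) : Set₁ where
  field
    {Base Code}      : Set
    base-fin         : Finite Base
    code-fin         : Finite Code
    anchor           : Code → Q → Base
    anchor-injective : ∀ f → Injective _≡_ _≡_ (anchor f)
    monochromatic    : ∀ (g : Base → Fin k) → ∃₂ λ f c → ∀ q → g (anchor f q) ≡ c

-- The codes are the colourings of the base.
anchoring : ∀ k {Q} → Finite Q → Anchoring k Q
anchoring k {Q} Q-fin = record
  { base-fin         = base-fin
  ; code-fin         = fin
  ; anchor           = λ f → proj₁ (proj₂ (embedding f))
  ; anchor-injective = λ f → proj₁ (proj₂ (proj₂ (embedding f)))
  ; monochromatic    = λ g → encode g , proj₁ (embedding (encode g)) ,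
      λ q → trans (sym (decode-encode g _)) (proj₂ (proj₂ (proj₂ (embedding (encode g)))) q)
  }
  where
  base-fin : Finite (Tower Q k)
  base-fin = tower-fin Q-fin k

  size : ℕ
  size = proj₁ base-fin

  index : Tower Q k ↔ Fin size
  index = proj₂ base-fin

  decode : Fin (k ^ size) → Tower Q k → Fin k
  decode f = finToFun f ∘ to index

  encode : (Tower Q k → Fin k) → Fin (k ^ size)
  encode g = funToFin (g ∘ from index)

  decode-encode : ∀ g x → decode (encode g) x ≡ g x
  decode-encode g x = trans (finToFun-funToFin _ (to index x)) (cong g (strictlyInverseʳ index x))

  embedding : ∀ f → ∃[ c ] Σ[ t ∈ (Q → Tower Q k) ] Injective _≡_ _≡_ t × (∀ q → decode f (t q) ≡ c)
  embedding f = monochromatic-embedding Q-fin k (decode f)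

-- Raising the chromatic number of a packing by one.

module Step {m s k : ℕ} (P : Packing (Fin m) (Fin s)) (𝒜 : Anchoring (suc k) (Anchor m)) where

  open Anchoring 𝒜

  Vertex : Set
  Vertex = Base ⊎ Code × Bool × Fin m

  Index : Set
  Index = Code × (Bool × Fin s ⊎ Fin m × Fin m)

  copy : Code → Bool → Fin m → Vertex
  copy f b w = inj₂ (f , b , w)

  copy-injective : ∀ f b → Injective _≡_ _≡_ (copy f b)
  copy-injective f b refl = refl

  link : Code → Fin m → Fin m → P₄ Vertex
  link f w w′ = path (copy f false w) (inj₁ (anchor f (false , w , w′)))
                     (copy f true w′) (inj₁ (anchor f (true , w , w′)))
    (((λ ()) ∷ (λ ()) ∷ (λ ()) ∷ []) ∷ ((λ ()) ∷ anchors-differ ∷ []) ∷ ((λ ()) ∷ []) ∷ [] ∷ [])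
    where
    anchors-differ : inj₁ (anchor f (false , w , w′)) ≢ inj₁ (anchor f (true , w , w′))
    anchors-differ eq with () ← anchor-injective f (inj₁-injective eq)

  -- A link alternates between copied vertices and anchors, so each of its edges has exactly one end
  -- in the base.
  AnchorEdge : Code → Fin m → Fin m → Vertex → Vertex → Set
  AnchorEdge f w w′ x y = ∃₂ λ b z → x ≡ inj₁ (anchor f (b , w , w′)) × y ≡ inj₂ (f , z)

  link-edge : ∀ {f w w′ x y} → HasEdge (link f w w′) x y →
    AnchorEdge f w w′ x y ⊎ AnchorEdge f w w′ y x
  link-edge (inj₁ (inj₁ (refl , refl)))        = inj₂ (_ , _ , refl , refl)
  link-edge (inj₁ (inj₂ (refl , refl)))        = inj₁ (_ , _ , refl , refl)
  link-edge (inj₂ (inj₁ (inj₁ (refl , refl)))) = inj₁ (_ , _ , refl , refl)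
  link-edge (inj₂ (inj₁ (inj₂ (refl , refl)))) = inj₂ (_ , _ , refl , refl)
  link-edge (inj₂ (inj₂ (inj₁ (refl , refl)))) = inj₂ (_ , _ , refl , refl)
  link-edge (inj₂ (inj₂ (inj₂ (refl , refl)))) = inj₁ (_ , _ , refl , refl)

  step-path : Index → P₄ Vertex
  step-path (f , inj₁ (b , i))  = map-path (copy f b) (copy-injective f b) (paths P i)
  step-path (f , inj₂ (w , w′)) = link f w w′

  -- Codes may share base vertices, so the code is read off the copied end; the injectivity of its
  -- anchors then recovers the pair from the base end.
  anchor-edge-unique : ∀ {f f′ w w′ v v′ x y} → AnchorEdge f w w′ x y → AnchorEdge f′ v v′ x y →
    _≡_ {A = Index} (f , inj₂ (w , w′)) (f′ , inj₂ (v , v′))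
  anchor-edge-unique {f} (_ , _ , refl , refl) (_ , _ , eq , refl)
    with refl ← anchor-injective f (inj₁-injective eq) = refl

  -- Both ends of a copied edge lie outside the base, while a link edge has one end inside.
  copy-link-disjoint : ∀ {f b i f′ w w′ x y} →
    HasEdge (step-path (f , inj₁ (b , i))) x y → ¬ HasEdge (link f′ w w′) x y
  copy-link-disjoint {f} {b} {i} e e′ with edge-map⁻ (copy f b) (copy-injective f b) (paths P i) e | link-edge e′
  ... | _ , _ , refl , _ , _ | inj₁ (_ , _ , () , _)
  ... | _ , _ , _ , refl , _ | inj₂ (_ , _ , () , _)

  step-disjoint : ∀ {i j u v} → HasEdge (step-path i) u v → HasEdge (step-path j) u v → i ≡ j
  step-disjoint {f , inj₁ (b , i)} {f′ , inj₁ (b′ , j)} e e′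
    with _ , _ , refl , refl , p ← edge-map⁻ (copy f b) (copy-injective f b) (paths P i) e
       | _ , _ , refl , refl , p′ ← edge-map⁻ (copy f′ b′) (copy-injective f′ b′) (paths P j) e′
    = cong (λ l → f , inj₁ (b , l)) (disjoint P p p′)
  step-disjoint {_ , inj₁ _} {_ , inj₂ _} e e′ = ⊥-elim (copy-link-disjoint e e′)
  step-disjoint {_ , inj₂ _} {_ , inj₁ _} e e′ = ⊥-elim (copy-link-disjoint e′ e)
  step-disjoint {_ , inj₂ _} {_ , inj₂ _} e e′ with link-edge e | link-edge e′
  ... | inj₁ a | inj₁ a′ = anchor-edge-unique a a′
  ... | inj₂ a | inj₂ a′ = anchor-edge-unique a a′
  ... | inj₁ (_ , _ , refl , _) | inj₂ (_ , _ , _ , ())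
  ... | inj₂ (_ , _ , refl , _) | inj₁ (_ , _ , _ , ())

  step : Packing Vertex Index
  step .paths    = step-path
  step .disjoint = step-disjoint

  vertex-fin : Finite Vertex
  vertex-fin = base-fin ⊎-fin code-fin ×-fin bool-fin ×-fin fin

  index-fin : Finite Index
  index-fin = code-fin ×-fin (bool-fin ×-fin fin ⊎-fin fin ×-fin fin)

  -- One fresh colour for the whole base: links alternate between it and old colours, and both
  -- copies keep the old colouring.
  step-colourable : PackingColourable P (suc k) → PackingColourable step (suc (suc k))
  step-colourable (c , ok) = c′ , ok′
    where
    c′ : Vertex → Fin (suc (suc k))
    c′ (inj₁ _)           = zero
    c′ (inj₂ (_ , _ , w)) = suc (c w)

    ok′ : IsPackingColouring step c′
    ok′ (f , inj₁ (b , i)) mono =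
      ok i (monochromatic-transfer (suc ∘ c) c (λ _ _ → suc-injective) (paths P i) mono)
    ok′ (f , inj₂ (w , w′)) (zero , () , _)
    ok′ (f , inj₂ (w , w′)) (suc _ , _ , () , _)

  omit-colour : ∀ {c : Fin m → Fin (suc k)} {c₀} → (∀ w → c₀ ≢ c w) →
    IsPackingColouring P c → PackingColourable P k
  omit-colour {c} c₀≢c ok = (λ w → punchOut (c₀≢c w)) , λ i mono →
    ok i (monochromatic-transfer _ c (λ u v → punchOut-injective (c₀≢c u) (c₀≢c v)) (paths P i) mono)

  -- If the colour c₀ of the anchors of f occurs in the first copy attached to f,
  -- then the links keep it out of the second.
  step-not-colourable : ¬ PackingColourable P k → ¬ PackingColourable step (suc k)
  step-not-colourable ¬col (g , ok) with f , c₀ , anchored ← monochromatic (g ∘ inj₁)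
    with exists? fin (λ w → c₀ ≟ g (copy f false w))
  ... | no avoids =
      ¬col (omit-colour (λ w eq → avoids (w , eq)) (λ i → ok (f , inj₁ (false , i))))
  ... | yes (w , c₀≡gw) =
      ¬col (omit-colour (λ w′ c₀≡gw′ → ok (f , inj₂ (w , w′))
                           (c₀ , sym c₀≡gw , anchored _ , sym c₀≡gw′ , anchored _))
                        (λ i → ok (f , inj₁ (true , i))))

-- Packings of every chromatic number.

ChromaticPacking : ℕ → Set
ChromaticPacking k = ∃₂ λ m s → Σ[ P ∈ Packing (Fin m) (Fin s) ]
  PackingColourable P (suc k) × ¬ PackingColourable P k

relabel : ∀ {k V I} → Finite V → Finite I → (P : Packing V I) →
  PackingColourable P (suc k) → ¬ PackingColourable P k → ChromaticPacking k
relabel {V = V} {I} (_ , V↔) (_ , I↔) P (c , ok) ¬col =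
  _ , _ , map-packing (to V↔) (to-injective V↔) (from I↔) (from-injective I↔) P ,
  (c ∘ from V↔ , λ i mono →
    ok (from I↔ i) (monochromatic-transfer (c ∘ from V↔ ∘ to V↔) c
      (λ u v → subst₂ (λ u′ v′ → c u′ ≡ c v′) (strictlyInverseʳ V↔ u) (strictlyInverseʳ V↔ v)) (paths P (from I↔ i)) mono)) ,
  λ (d , ok′) → ¬col (d ∘ to V↔ , λ i →
    subst (λ j → ¬ Monochromatic (d ∘ to V↔) (paths P j)) (strictlyInverseʳ I↔ i) (ok′ (to I↔ i)))

-- Start of the induction: with no path one colour suffices, and the single vertex rules out a
-- colouring into `Fin 0`.
edgeless : Packing (Fin 1) (Fin 0)
edgeless .paths ()
edgeless .disjoint {()}

chromatic-packing : ∀ k → ChromaticPacking k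
chromatic-packing zero = 1 , 0 , edgeless , ((λ _ → zero) , λ ()) , λ (c , _) → ¬Fin0 (c zero)
  where
  ¬Fin0 : ¬ Fin 0
  ¬Fin0 ()
chromatic-packing (suc k) with m , s , P , col , ¬col ← chromatic-packing k =
  relabel vertex-fin index-fin step (step-colourable col) (step-not-colourable ¬col)
  where open Step {k = k} P (anchoring (suc k) anchor-fin)

-- Lists of paths covering an edge exactly once.

-- An inductive form of the unique index in `partition`. It passes through concatenation and
-- mapping, and it is decidable, so small decompositions can be checked by evaluation.
data Once {A : Set} (P : A → Set) : List A → Set where
  here  : ∀ {x xs} → P x → All (¬_ ∘ P) xs → Once P (x ∷ xs)
  there : ∀ {x xs} → ¬ P x → Once P xs → Once P (x ∷ xs)

module _ {A : Set} {P : A → Set} where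

  once-++ˡ : ∀ {xs ys} → Once P xs → All (¬_ ∘ P) ys → Once P (xs ++ ys)
  once-++ˡ (here p ¬xs)  ¬ys = here p (All.++⁺ ¬xs ¬ys)
  once-++ˡ (there ¬p xs) ¬ys = there ¬p (once-++ˡ xs ¬ys)

  once-++ʳ : ∀ {xs ys} → All (¬_ ∘ P) xs → Once P ys → Once P (xs ++ ys)
  once-++ʳ []         ys = ys
  once-++ʳ (¬p ∷ ¬xs) ys = there ¬p (once-++ʳ ¬xs ys)

  never-concat-tabulate : ∀ {n} {f : Fin n → List A} →
    (∀ i → All (¬_ ∘ P) (f i)) → All (¬_ ∘ P) (concat (tabulate f))
  never-concat-tabulate ¬f = All.concat⁺ (All.tabulate⁺ ¬f)

  once-concat-tabulate : ∀ {n} {f : Fin n → List A} i →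
    Once P (f i) → (∀ j → j ≢ i → All (¬_ ∘ P) (f j)) → Once P (concat (tabulate f))
  once-concat-tabulate zero    once never = once-++ˡ once (never-concat-tabulate (λ j → never (suc j) λ ()))
  once-concat-tabulate (suc i) once never = once-++ʳ (never zero λ ())
    (once-concat-tabulate i once (λ j j≢i → never (suc j) (λ { refl → j≢i refl })))

  once⇒∃! : ∀ {xs} → Once P xs → ∃! _≡_ (λ (i : Fin (length xs)) → P (lookup xs i))
  once⇒∃! (here p ¬xs) = zero , p , λ { {zero} _ → refl ; {suc j} q → ⊥-elim (All.lookup ¬xs (∈-lookup j) q) }
  once⇒∃! (there ¬p xs) with i , p , unique ← once⇒∃! xs =
    suc i , p , λ { {zero} q → ⊥-elim (¬p q) ; {suc j} q → cong suc (unique q) }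

  once? : (∀ x → Dec (P x)) → ∀ xs → Dec (Once P xs)
  once? P? []       = no λ ()
  once? P? (x ∷ xs) with P? x
  ... | yes p = map′ (here p) (λ { (here _ ¬xs) → ¬xs ; (there ¬p _) → ⊥-elim (¬p p) }) (All.all? (¬? ∘ P?) xs)
  ... | no ¬p = map′ (there ¬p) (λ { (here p _) → ⊥-elim (¬p p) ; (there _ xs) → xs }) (once? P? xs)

once-map : ∀ {A B : Set} {P : A → Set} {Q : B → Set} {f : A → B} →
  (∀ x → P x → Q (f x)) → (∀ x → Q (f x) → P x) → ∀ {xs} → Once P xs → Once Q (map f xs)
once-map P⇒Q Q⇒P (here p ¬xs)  = here (P⇒Q _ p) (All.map⁺ (All.map (λ ¬p q → ¬p (Q⇒P _ q)) ¬xs))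
once-map P⇒Q Q⇒P (there ¬p xs) = there (¬p ∘ Q⇒P _) (once-map P⇒Q Q⇒P xs)

module _ {V : Set} where

  Joined Unjoined : List (P₄ V) → V → V → Set
  Joined   ps x y = Once (λ p → HasEdge p x y) ps
  Unjoined ps x y = All (λ p → ¬ HasEdge p x y) ps

  edge-sym : ∀ (p : P₄ V) {x y} → HasEdge p x y → HasEdge p y x
  edge-sym p = map-⊎ flip (map-⊎ flip flip)
    where
    flip : ∀ {x y a b : V} → SamePair x y a b → SamePair y x a b
    flip (inj₁ (e , e′)) = inj₂ (e′ , e)
    flip (inj₂ (e , e′)) = inj₁ (e′ , e)

  edge-irrefl : ∀ (p : P₄ V) {x} → ¬ HasEdge p x x
  edge-irrefl (path _ _ _ _ ((a≢b ∷ _) ∷ (b≢c ∷ _) ∷ (c≢d ∷ _) ∷ _)) =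
    [ loop a≢b , [ loop b≢c , loop c≢d ] ]
    where
    loop : ∀ {x a b : V} → a ≢ b → ¬ SamePair x x a b
    loop a≢b (inj₁ (refl , refl)) = a≢b refl
    loop a≢b (inj₂ (refl , refl)) = a≢b refl

  joined-sym : ∀ {ps x y} → Joined ps x y → Joined ps y x
  joined-sym (here {p} e ¬es) = here (edge-sym p e) (All.map (λ {q} ¬e → ¬e ∘ edge-sym q) ¬es)
  joined-sym (there {p} ¬e es) = there (¬e ∘ edge-sym p) (joined-sym es)

  unjoined-sym : ∀ {ps x y} → Unjoined ps x y → Unjoined ps y x
  unjoined-sym = All.map (λ {q} ¬e → ¬e ∘ edge-sym q)

  module _ (_≟ᵥ_ : DecidableEquality V) where

    edge? : ∀ (p : P₄ V) x y → Dec (HasEdge p x y)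
    edge? (path a b c d _) x y = same? a b ⊎-dec same? b c ⊎-dec same? c d
      where
      same? : ∀ a b → Dec (SamePair x y a b)
      same? a b = (x ≟ᵥ a ×-dec y ≟ᵥ b) ⊎-dec (x ≟ᵥ b ×-dec y ≟ᵥ a)

    joined? : ∀ ps x y → Dec (Joined ps x y)
    joined? ps x y = once? (λ p → edge? p x y) ps

    unjoined? : ∀ ps x y → Dec (Unjoined ps x y)
    unjoined? ps x y = All.all? (λ p → ¬? (edge? p x y)) ps

module _ {A B : Set} (f : A → B) (f-inj : Injective _≡_ _≡_ f) where

  joined-map : ∀ {ps a b} → Joined ps a b → Joined (map (map-path f f-inj) ps) (f a) (f b)
  joined-map {ps} {a} {b} = once-map (λ p → edge-map⁺ f f-inj p) reflect
    where
    reflect : ∀ p → HasEdge (map-path f f-inj p) (f a) (f b) → HasEdge p a b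
    reflect p e with _ , _ , eq , eq′ , e′ ← edge-map⁻ f f-inj p e
      with refl ← f-inj eq | refl ← f-inj eq′ = e′

  -- An image path covers only pairs of image vertices, so a use of this lemma refutes the equations
  -- for the preimages that cannot occur and inspects the rest.
  unjoined-map : ∀ {ps x y} → (∀ a b → x ≡ f a → y ≡ f b → Unjoined ps a b) →
    Unjoined (map (map-path f f-inj) ps) x y
  unjoined-map unjoined = All.map⁺ (All.tabulate λ {p} p∈ps e →
    let (a , b , x≡ , y≡ , e′) = edge-map⁻ f f-inj p e in All.lookup (unjoined a b x≡ y≡) p∈ps e′)

-- Small decompositions and hubs.

vertices : {V : Set} → P₄ V → List V
vertices (path a b c d _) = a ∷ b ∷ c ∷ d ∷ []

-- The right-hand summand stands for a triple whose three colours differ.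
TwoRight : {A : Set} → P₄ (A ⊎ Fin 3) → Set
TwoRight p = ∃₂ λ i j → i ≢ j × inj₂ i ∈ vertices p × inj₂ j ∈ vertices p

two-right⇒non-monochromatic : ∀ {A k} (c : A ⊎ Fin 3 → Fin k) → Injective _≡_ _≡_ (c ∘ inj₂) →
  ∀ p → TwoRight p → ¬ Monochromatic c p
two-right⇒non-monochromatic c c-inj p (i , j , i≢j , i∈p , j∈p) (x , e₁ , e₂ , e₃ , e₄) =
  i≢j (c-inj (trans (All.lookup colours i∈p) (sym (All.lookup colours j∈p))))
  where
  colours : All (λ v → c v ≡ x) (vertices p)
  colours = e₁ ∷ e₂ ∷ e₃ ∷ e₄ ∷ []

monochromatic? : ∀ {V k} (c : V → Fin k) p → Dec (Monochromatic c p)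
monochromatic? c (path a₁ a₂ a₃ a₄ _) =
  any? λ x → c a₁ ≟ x ×-dec c a₂ ≟ x ×-dec c a₃ ≟ x ×-dec c a₄ ≟ x

module Gadgets {h : ℕ} where

  _≟ᵥ_ : DecidableEquality (Fin h ⊎ Fin 3)
  _≟ᵥ_ = Sum.≡-dec _≟_ _≟_

  two-right? : ∀ (p : P₄ (Fin h ⊎ Fin 3)) → Dec (TwoRight p)
  two-right? p = any? λ i → any? λ j →
    ¬? (i ≟ j) ×-dec (inj₂ i ∈? vertices p) ×-dec (inj₂ j ∈? vertices p)
    where open DecMembership _≟ᵥ_ using (_∈?_)

  ⟨_,_,_,_⟩ : ∀ a b c d → {True (DecUnique.unique? _≟ᵥ_ (a ∷ b ∷ c ∷ d ∷ []))} → P₄ (Fin h ⊎ Fin 3)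
  ⟨ a , b , c , d ⟩ {distinct} = path a b c d (toWitness distinct)

open Gadgets using (⟨_,_,_,_⟩; two-right?)

pattern l i = inj₁ i
pattern r i = inj₂ i

-- K₃,₃ on two triples, or K₃,₃ minus the perfect matching {l i, r i}.
bipartite : (matched : Bool) → List (P₄ (Fin 3 ⊎ Fin 3))
bipartite false = ⟨ l 0F , r 0F , l 1F , r 2F ⟩ ∷ ⟨ l 1F , r 1F , l 2F , r 0F ⟩ ∷ ⟨ l 2F , r 2F , l 0F , r 1F ⟩ ∷ []
bipartite true  = ⟨ l 0F , r 1F , l 2F , r 0F ⟩ ∷ ⟨ r 0F , l 1F , r 2F , l 0F ⟩ ∷ []

-- Each path alternates between the two triples, so two of its four vertices lie on the right.
bipartite-two-right : ∀ m → All TwoRight (bipartite m)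
bipartite-two-right false = from-yes (All.all? two-right? (bipartite false))
bipartite-two-right true  = from-yes (All.all? two-right? (bipartite true))

bipartite-left : ∀ m i j → Unjoined (bipartite m) (l i) (l j)
bipartite-left false = from-yes (all? λ i → all? λ j → unjoined? Gadgets._≟ᵥ_ (bipartite false) (l i) (l j))
bipartite-left true  = from-yes (all? λ i → all? λ j → unjoined? Gadgets._≟ᵥ_ (bipartite true) (l i) (l j))

bipartite-right : ∀ m i j → Unjoined (bipartite m) (r i) (r j)
bipartite-right false = from-yes (all? λ i → all? λ j → unjoined? Gadgets._≟ᵥ_ (bipartite false) (r i) (r j))
bipartite-right true  = from-yes (all? λ i → all? λ j → unjoined? Gadgets._≟ᵥ_ (bipartite true) (r i) (r j))

bipartite-across : ∀ i j → Joined (bipartite false) (l i) (r j)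
bipartite-across = from-yes (all? λ i → all? λ j → joined? Gadgets._≟ᵥ_ (bipartite false) (l i) (r j))

bipartite-unmatched : ∀ i j → i ≢ j → Joined (bipartite true) (l i) (r j)
bipartite-unmatched = from-yes (all? λ i → all? λ j → ¬? (i ≟ j) →-dec joined? Gadgets._≟ᵥ_ (bipartite true) (l i) (r j))

bipartite-matched : ∀ i → Unjoined (bipartite true) (l i) (r i)
bipartite-matched = from-yes (all? λ i → unjoined? Gadgets._≟ᵥ_ (bipartite true) (l i) (r i))

-- A decomposed complete graph on h further vertices, and a decomposition
-- (the spokes) of K₃ together with K₃,ₕ.
record Hub (h : ℕ) : Set where
  field
    core             : List (P₄ (Fin h))
    core-joined      : ∀ a b → a ≢ b → Joined core a b
    core-colour      : Fin h → Fin 3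
    core-coloured    : All (λ p → ¬ Monochromatic core-colour p) core
    spokes           : List (P₄ (Fin h ⊎ Fin 3))
    spokes-hub       : ∀ a b → Unjoined spokes (l a) (l b)
    spokes-across    : ∀ a i → Joined spokes (l a) (r i)
    spokes-triangle  : ∀ i j → i ≢ j → Joined spokes (r i) (r j)
    spokes-two-right : All TwoRight spokes

mkHub : ∀ {h} (core : List (P₄ (Fin h))) (colour : Fin h → Fin 3) (spokes : List (P₄ (Fin h ⊎ Fin 3))) →
  {True (all? λ a → all? λ b → ¬? (a ≟ b) →-dec joined? _≟_ core a b)} →
  {True (All.all? (λ p → ¬? (monochromatic? colour p)) core)} →
  {True (all? λ a → all? λ b → unjoined? Gadgets._≟ᵥ_ spokes (l a) (l b))} →
  {True (all? λ a → all? λ i → joined? Gadgets._≟ᵥ_ spokes (l a) (r i))} →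
  {True (all? λ i → all? λ j → ¬? (i ≟ j) →-dec joined? Gadgets._≟ᵥ_ spokes (r i) (r j))} →
  {True (All.all? two-right? spokes)} → Hub h
mkHub core colour spokes {t₁} {t₂} {t₃} {t₄} {t₅} {t₆} = record
  { core = core ; core-joined = toWitness t₁ ; core-colour = colour ; core-coloured = toWitness t₂
  ; spokes = spokes ; spokes-hub = toWitness t₃ ; spokes-across = toWitness t₄
  ; spokes-triangle = toWitness t₅ ; spokes-two-right = toWitness t₆ }

-- One hub vertex and a triple form K₄, which is two paths.
hub₁ : Hub 1
hub₁ = mkHub [] (λ _ → 0F)
  (⟨ l 0F , r 0F , r 1F , r 2F ⟩ ∷ ⟨ r 0F , r 2F , l 0F , r 1F ⟩ ∷ [])

-- Six is the least multiple of 3 possible: with none, the spokes would have to decompose K₃, with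
-- three, the core would, and K₃ contains no path on four vertices.
hub₆ : Hub 6
hub₆ = mkHub
  -- The path (∞, i, i+1, i+3) developed modulo 5, with `5F` as the fixed point ∞.
  (⟪ 5F , 0F , 1F , 3F ⟫ ∷ ⟪ 5F , 1F , 2F , 4F ⟫ ∷ ⟪ 5F , 2F , 3F , 0F ⟫ ∷
   ⟪ 5F , 3F , 4F , 1F ⟫ ∷ ⟪ 5F , 4F , 0F , 2F ⟫ ∷ [])
  -- Classes of size two, too small to contain a path.
  (λ { 0F → 0F ; 1F → 0F ; 2F → 1F ; 3F → 1F ; 4F → 2F ; 5F → 2F })
  -- The first four paths use hub vertices 0 to 2 and contain the triangle; the last three are
  -- `bipartite false` on hub vertices 3 to 5.
  (⟨ l 0F , r 0F , l 1F , r 1F ⟩ ∷ ⟨ l 0F , r 1F , l 2F , r 2F ⟩ ∷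
   ⟨ l 0F , r 2F , r 0F , l 2F ⟩ ∷ ⟨ l 1F , r 2F , r 1F , r 0F ⟩ ∷
   ⟨ l 3F , r 0F , l 4F , r 2F ⟩ ∷ ⟨ l 4F , r 1F , l 5F , r 0F ⟩ ∷ ⟨ l 5F , r 2F , l 3F , r 1F ⟩ ∷ [])
  where
  ⟪_,_,_,_⟫ : ∀ a b c d → {True (DecUnique.unique? _≟_ (a ∷ b ∷ c ∷ d ∷ []))} → P₄ (Fin 6)
  ⟪ a , b , c , d ⟫ {distinct} = path a b c d (toWitness distinct)

-- Cyclic shifts of colours.

module _ {n : ℕ} where

  -- The cyclic shift x ↦ x - 1 modulo n + 1.
  rotate : Fin (suc n) → Fin (suc n)
  rotate zero    = fromℕ n
  rotate (suc i) = inject₁ i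

  rotate-injective : Injective _≡_ _≡_ rotate
  rotate-injective {zero}  {zero}  _  = refl
  rotate-injective {zero}  {suc j} eq = contradiction eq fromℕ≢inject₁
  rotate-injective {suc i} {zero}  eq = contradiction (sym eq) fromℕ≢inject₁
  rotate-injective {suc i} {suc j} eq = cong suc (inject₁-injective eq)

inject₁≢suc : ∀ {n} (i : Fin n) → inject₁ i ≢ suc i
inject₁≢suc (suc i) eq = inject₁≢suc i (suc-injective eq)

rotate-≢ : ∀ {n} (i : Fin (2 + n)) → rotate i ≢ i
rotate-≢ zero    ()
rotate-≢ (suc i) = inject₁≢suc i

rotate²-≢ : ∀ {n} (i : Fin (3 + n)) → rotate (rotate i) ≢ i
rotate²-≢ zero          ()
rotate²-≢ (suc zero)    ()
-- From 2 on, two rotations lower the value by 2.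
rotate²-≢ (suc (suc i)) eq = ℕ.m≢1+n+m (toℕ i)
  (trans (sym (trans (toℕ-inject₁ (inject₁ i)) (toℕ-inject₁ i))) (cong toℕ eq))

-- Colours the i-th vertex of a triple. Injectivity for fixed i keeps parallel copies of a path
-- non-monochromatic; injectivity in i, which needs at least three colours, makes each triple
-- rainbow.
shift : ∀ {n} → Fin 3 → Fin (3 + n) → Fin (3 + n)
shift 0F = id
shift 1F = rotate
shift 2F = rotate ∘ rotate

shift-injective : ∀ {n} i → Injective _≡_ _≡_ (shift {n} i)
shift-injective 0F = id
shift-injective 1F = rotate-injective
shift-injective 2F = rotate-injective ∘ rotate-injective

shift-rainbow : ∀ {n} (x : Fin (3 + n)) → Injective _≡_ _≡_ (λ i → shift i x)
shift-rainbow x {0F} {0F} _  = refl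
shift-rainbow x {0F} {1F} eq = ⊥-elim (rotate-≢ x (sym eq))
shift-rainbow x {0F} {2F} eq = ⊥-elim (rotate²-≢ x (sym eq))
shift-rainbow x {1F} {0F} eq = ⊥-elim (rotate-≢ x eq)
shift-rainbow x {1F} {1F} _  = refl
shift-rainbow x {1F} {2F} eq = ⊥-elim (rotate-≢ (rotate x) (sym eq))
shift-rainbow x {2F} {0F} eq = ⊥-elim (rotate²-≢ x eq)
shift-rainbow x {2F} {1F} eq = ⊥-elim (rotate-≢ (rotate x) eq)
shift-rainbow x {2F} {2F} _  = refl

-- Completing a packing to a system.

module Completion {h n s k : ℕ} (H : Hub h) (P : Packing (Fin n) (Fin s)) where

  open Hub H

  Vertex : Set
  Vertex = Fin h ⊎ Fin n × Fin 3

  core-list : List (P₄ Vertex)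
  core-list = map (map-path inj₁ inj₁-injective) core

  spoke-vertex : Fin n → Fin h ⊎ Fin 3 → Vertex
  spoke-vertex u = map-⊎₂ (u ,_)

  spoke-vertex-injective : ∀ u → Injective _≡_ _≡_ (spoke-vertex u)
  spoke-vertex-injective u {l _} {l _} refl = refl
  spoke-vertex-injective u {r _} {r _} refl = refl

  spokes-at : Fin n → List (P₄ Vertex)
  spokes-at u = map (map-path (spoke-vertex u) (spoke-vertex-injective u)) spokes

  copy-vertex : Fin 3 → Fin n → Vertex
  copy-vertex i u = inj₂ (u , i)

  copy-vertex-injective : ∀ i → Injective _≡_ _≡_ (copy-vertex i)
  copy-vertex-injective i refl = refl

  copy : Fin s → Fin 3 → List (P₄ Vertex)
  copy e i = map (map-path (copy-vertex i) (copy-vertex-injective i)) (paths P e ∷ [])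

  pair-vertex : Fin n → Fin n → Fin 3 ⊎ Fin 3 → Vertex
  pair-vertex u v = [ (λ i → inj₂ (u , i)) , (λ i → inj₂ (v , i)) ]

  pair-vertex-injective : ∀ {u v} → u ≢ v → Injective _≡_ _≡_ (pair-vertex u v)
  pair-vertex-injective u≢v {l _} {l _} refl = refl
  pair-vertex-injective u≢v {l _} {r _} eq   = ⊥-elim (u≢v (,-injectiveˡ (inj₂-injective eq)))
  pair-vertex-injective u≢v {r _} {l _} eq   = ⊥-elim (u≢v (sym (,-injectiveˡ (inj₂-injective eq))))
  pair-vertex-injective u≢v {r _} {r _} refl = refl

  matched? : ∀ u v → Dec (∃[ e ] HasEdge (paths P e) u v)
  matched? u v = any? λ e → edge? _≟_ (paths P e) u v

  -- Nothing unless `u < v`, so that two triples are joined in one order only.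
  pair-if : ∀ {u v} → Dec (u < v) → List (P₄ Vertex)
  pair-if             (no _)    = []
  pair-if {u} {v} (yes u<v) = map (map-path (pair-vertex u v) (pair-vertex-injective (<⇒≢ u<v))) (bipartite (does (matched? u v)))

  pair : Fin n → Fin n → List (P₄ Vertex)
  pair u v = pair-if (u <? v)

  spokes-list copies-list pairs-list : List (P₄ Vertex)
  spokes-list = concat (tabulate spokes-at)
  copies-list = concat (tabulate λ e → concat (tabulate (copy e)))
  pairs-list  = concat (tabulate λ u → concat (tabulate (pair u)))

  core-off : ∀ {x v} → Unjoined core-list x (inj₂ v)
  core-off = unjoined-map inj₁ inj₁-injective (λ _ _ _ ())

  spokes-off-hub : ∀ {a b} → Unjoined spokes-list (inj₁ a) (inj₁ b)
  spokes-off-hub = never-concat-tabulate λ u → unjoined-map (spoke-vertex u) (spoke-vertex-injective u)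
    λ { (l _) (l _) refl refl → spokes-hub _ _ ; (l _) (r _) _ () ; (r _) _ () _ }

  spokes-at-off : ∀ {u v x i} → u ≢ v → Unjoined (spokes-at u) x (inj₂ (v , i))
  spokes-at-off {u} u≢v = unjoined-map (spoke-vertex u) (spoke-vertex-injective u)
    λ { _ (l _) _ () ; _ (r _) _ refl → ⊥-elim (u≢v refl) }

  spokes-list-across : ∀ {a u i} → Joined spokes-list (inj₁ a) (inj₂ (u , i))
  spokes-list-across {a} {u} {i} = once-concat-tabulate u
    (joined-map (spoke-vertex u) (spoke-vertex-injective u) (spokes-across a i))
    λ _ → spokes-at-off

  spokes-list-triangle : ∀ {u i j} → i ≢ j → Joined spokes-list (inj₂ (u , i)) (inj₂ (u , j))
  spokes-list-triangle {u} i≢j = once-concat-tabulate u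
    (joined-map (spoke-vertex u) (spoke-vertex-injective u) (spokes-triangle _ _ i≢j))
    λ _ → spokes-at-off

  -- Spokes at `w` meet one triple only, and `w` differs from `u` or from `v`.
  spokes-off-pairs : ∀ {u v i j} → u ≢ v → Unjoined spokes-list (inj₂ (u , i)) (inj₂ (v , j))
  spokes-off-pairs {u} {v} u≢v = never-concat-tabulate off
    where
    off : ∀ w → Unjoined (spokes-at w) _ _
    off w with w ≟ v
    ... | no w≢v   = spokes-at-off w≢v
    ... | yes refl = unjoined-sym (spokes-at-off (≢-sym u≢v))

  copies-off : ∀ {x y} → (∀ e i u v → x ≡ inj₂ (u , i) → y ≡ inj₂ (v , i) → ¬ HasEdge (paths P e) u v) →
    Unjoined copies-list x y
  copies-off off = never-concat-tabulate λ e → never-concat-tabulate λ i →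
    unjoined-map (copy-vertex i) (copy-vertex-injective i) {ps = paths P e ∷ []} λ u v x≡ y≡ → off e i u v x≡ y≡ ∷ []

  -- A copy on another level misses both vertices; on the same level a second path through the edge
  -- would contradict `disjoint`.
  copies-list-matched : ∀ {e u v i} → HasEdge (paths P e) u v →
    Joined copies-list (inj₂ (u , i)) (inj₂ (v , i))
  copies-list-matched {e} {u} {v} {i} edge = once-concat-tabulate e
    (once-concat-tabulate i
      (joined-map (copy-vertex i) (copy-vertex-injective i) {ps = paths P e ∷ []} (here edge []))
      (λ j j≢i → unjoined-map (copy-vertex j) (copy-vertex-injective j) {ps = paths P e ∷ []}
        λ { _ _ refl refl → ⊥-elim (j≢i refl) }))
    λ e′ e′≢e → never-concat-tabulate λ j → unjoined-map (copy-vertex j) (copy-vertex-injective j) {ps = paths P e′ ∷ []}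
      λ { _ _ refl refl → (λ edge′ → e′≢e (disjoint P edge′ edge)) ∷ [] }

  -- The gadget only joins the triple of `u` to that of `v`; the two hypotheses exclude the two
  -- orientations of such an edge.
  pair-off : ∀ {x y} u v →
    (∀ i j → u < v → x ≡ inj₂ (u , i) → y ≢ inj₂ (v , j)) →
    (∀ i j → u < v → y ≡ inj₂ (u , i) → x ≢ inj₂ (v , j)) → Unjoined (pair u v) x y
  pair-off u v off off′ with u <? v
  ... | no _    = []
  ... | yes u<v = unjoined-map (pair-vertex u v) (pair-vertex-injective (<⇒≢ u<v)) λ where
    (l i) (l j) _  _   → bipartite-left _ i j
    (l i) (r j) x≡ y≡  → ⊥-elim (off i j u<v x≡ y≡)
    (r i) (l j) x≡ y≡  → ⊥-elim (off′ j i u<v y≡ x≡)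
    (r i) (r j) _  _   → bipartite-right _ i j

  pairs-off : ∀ {x y} →
    (∀ u v i j → u < v → x ≡ inj₂ (u , i) → y ≢ inj₂ (v , j)) →
    (∀ u v i j → u < v → y ≡ inj₂ (u , i) → x ≢ inj₂ (v , j)) → Unjoined pairs-list x y
  pairs-off off off′ = never-concat-tabulate λ u → never-concat-tabulate λ v →
    pair-off u v (off u v) (off′ u v)

  pairs-list-joined : ∀ {u v i j} → u < v → Joined (bipartite (does (matched? u v))) (l i) (r j) →
    Joined pairs-list (inj₂ (u , i)) (inj₂ (v , j))
  pairs-list-joined {u} {v} {i} {j} u<v once =
    once-concat-tabulate u (once-concat-tabulate v at-pair
      (λ w w≢v → pair-off u w (λ { _ _ _ _ refl → w≢v refl }) (λ { _ _ _ refl refl → <-asym u<v u<v })))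
    λ w w≢u → never-concat-tabulate λ w′ → pair-off w w′
      (λ { _ _ _ refl → ⊥-elim (w≢u refl) }) (λ { _ _ v<u refl refl → <-asym u<v v<u })
    where
    at-pair : Joined (pair u v) (inj₂ (u , i)) (inj₂ (v , j))
    at-pair with u <? v
    ... | yes u<v′ = joined-map (pair-vertex u v) (pair-vertex-injective (<⇒≢ u<v′)) once
    ... | no u≮v   = ⊥-elim (u≮v u<v)

  pairs-list-unjoined : ∀ {u v i j} → u < v → Unjoined (bipartite (does (matched? u v))) (l i) (r j) →
    Unjoined pairs-list (inj₂ (u , i)) (inj₂ (v , j))
  pairs-list-unjoined {u} {v} {i} {j} u<v never = never-concat-tabulate λ w → never-concat-tabulate λ w′ → at w w′
    where
    at : ∀ w w′ → Unjoined (pair w w′) (inj₂ (u , i)) (inj₂ (v , j))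
    at w w′ with w <? w′
    ... | no _     = []
    ... | yes w<w′ = unjoined-map (pair-vertex w w′) (pair-vertex-injective (<⇒≢ w<w′)) λ where
      (l _) (l _) _    _    → bipartite-left _ _ _
      (l _) (r _) refl refl → never
      (r _) (l _) refl refl → ⊥-elim (<-asym u<v w<w′)
      (r _) (r _) _    _    → bipartite-right _ _ _

  all-paths : List (P₄ Vertex)
  all-paths = core-list ++ spokes-list ++ copies-list ++ pairs-list

  off-core : ∀ {x v} → Joined (spokes-list ++ copies-list ++ pairs-list) x (inj₂ v) → Joined all-paths x (inj₂ v)
  off-core = once-++ʳ core-off

  -- In a matched pair the copies cover the three edges with i = j and the hexagon the other six; in
  -- an unmatched pair K₃,₃ covers all nine.
  pair-joined : ∀ {u v} i j → u < v → Joined all-paths (inj₂ (u , i)) (inj₂ (v , j))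
  pair-joined {u} {v} i j u<v = off-core (once-++ʳ (spokes-off-pairs (<⇒≢ u<v)) (copies-pairs (matched? u v) refl))
    where
    -- The decision comes with an equation so that only the gadget is rewritten and `pairs-list`
    -- stays intact.
    copies-pairs : (d : Dec (∃[ e ] HasEdge (paths P e) u v)) → matched? u v ≡ d →
      Joined (copies-list ++ pairs-list) (inj₂ (u , i)) (inj₂ (v , j))
    copies-pairs (no unmatched) eq = once-++ʳ
      (copies-off λ { e _ _ _ refl refl edge → unmatched (e , edge) })
      (pairs-list-joined u<v (subst (λ d → Joined (bipartite (does d)) (l i) (r j)) (sym eq) (bipartite-across i j)))
    copies-pairs (yes (e , edge)) eq with i ≟ j
    ... | yes refl = once-++ˡ (copies-list-matched edge)
      (pairs-list-unjoined u<v (subst (λ d → Unjoined (bipartite (does d)) (l i) (r i)) (sym eq) (bipartite-matched i)))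
    ... | no i≢j = once-++ʳ (copies-off λ { _ _ _ _ refl refl _ → i≢j refl })
      (pairs-list-joined u<v (subst (λ d → Joined (bipartite (does d)) (l i) (r j)) (sym eq) (bipartite-unmatched i j i≢j)))

  hub-triple-joined : ∀ a u i → Joined all-paths (inj₁ a) (inj₂ (u , i))
  hub-triple-joined a u i = off-core (once-++ˡ spokes-list-across
    (All.++⁺ (copies-off λ _ _ _ _ ()) (pairs-off (λ _ _ _ _ _ ()) (λ _ _ _ _ _ _ ()))))

  all-joined : ∀ x y → x ≢ y → Joined all-paths x y
  all-joined (inj₁ a) (inj₁ b) a≢b = once-++ˡ
    (joined-map inj₁ inj₁-injective (core-joined a b (a≢b ∘ cong inj₁)))
    (All.++⁺ spokes-off-hub (All.++⁺ (copies-off λ _ _ _ _ ()) (pairs-off (λ _ _ _ _ _ ()) (λ _ _ _ _ _ ()))))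
  all-joined (inj₁ a) (inj₂ (u , i)) _ = hub-triple-joined a u i
  all-joined (inj₂ (u , i)) (inj₁ a) _ = joined-sym (hub-triple-joined a u i)
  all-joined (inj₂ (u , i)) (inj₂ (v , j)) x≢y with <-cmp u v
  ... | tri< u<v _ _  = pair-joined i j u<v
  ... | tri> _ _ v<u  = joined-sym (pair-joined j i v<u)
  ... | tri≈ _ refl _ = off-core (once-++ˡ (spokes-list-triangle (λ { refl → x≢y refl }))
    (All.++⁺ (copies-off λ { e _ _ _ refl refl → edge-irrefl (paths P e) })
             (pairs-off (λ { _ _ _ _ u<u refl refl → <-asym u<u u<u }) (λ { _ _ _ _ u<u refl refl → <-asym u<u u<u }))))

  vertices↔ : Vertex ↔ Fin (h + n * 3)
  vertices↔ = proj₂ (fin ⊎-fin fin ×-fin fin)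

  completion : P₄System (h + n * 3)
  completion = record
    { blocks    = map (map-path (to vertices↔) (to-injective vertices↔)) all-paths
    ; partition = λ x y x≢y → once⇒∃! (joined x y x≢y)
    }
    where
    joined : ∀ x y → x ≢ y → Joined (map (map-path (to vertices↔) (to-injective vertices↔)) all-paths) x y
    joined x y x≢y = subst₂ (Joined (map _ all-paths)) (strictlyInverseˡ vertices↔ x) (strictlyInverseˡ vertices↔ y)
      (joined-map (to vertices↔) (to-injective vertices↔)
        (all-joined (from vertices↔ x) (from vertices↔ y) (x≢y ∘ from-injective vertices↔)))

  module _ (c : Fin n → Fin (3 + k)) (c-ok : IsPackingColouring P c) where

    colour : Vertex → Fin (3 + k)
    -- Every path leaving the hub has two vertices in one triple, so hub colours matter for the core
    -- alone.
    colour (inj₁ a)       = core-colour a ↑ˡ k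
    colour (inj₂ (u , i)) = shift i (c u)

    Coloured : List (P₄ Vertex) → Set
    Coloured = All (λ p → ¬ Monochromatic colour p)

    gadget-coloured : ∀ {A} (f : A ⊎ Fin 3 → Vertex) (f-inj : Injective _≡_ _≡_ f) u → (∀ i → f (inj₂ i) ≡ inj₂ (u , i)) →
      ∀ {ps} → All TwoRight ps → Coloured (map (map-path f f-inj) ps)
    gadget-coloured f f-inj u f-right two-right = All.map⁺ (All.map
      (λ {p} → two-right⇒non-monochromatic (colour ∘ f)
        (λ {i} {j} eq → shift-rainbow (c u) (subst₂ (λ x y → colour x ≡ colour y) (f-right i) (f-right j) eq)) p)
      two-right)

    core-list-coloured : Coloured core-list
    core-list-coloured = All.map⁺ (All.map
      (λ {p} ¬mono mono → ¬mono (monochromatic-transfer _ core-colour (λ a b → ↑ˡ-injective k _ _) p mono)) core-coloured)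

    spokes-at-coloured : ∀ u → Coloured (spokes-at u)
    spokes-at-coloured u = gadget-coloured (spoke-vertex u) (spoke-vertex-injective u) u (λ _ → refl) spokes-two-right

    copy-coloured : ∀ e i → Coloured (copy e i)
    copy-coloured e i = (λ mono → c-ok e (monochromatic-transfer _ c (λ _ _ → shift-injective i) (paths P e) mono)) ∷ []

    pair-coloured : ∀ u v → Coloured (pair u v)
    pair-coloured u v with u <? v
    ... | no _    = []
    ... | yes u<v = gadget-coloured (pair-vertex u v) (pair-vertex-injective (<⇒≢ u<v)) v (λ _ → refl) (bipartite-two-right _)

    all-coloured : Coloured all-paths
    all-coloured = All.++⁺ core-list-coloured
      (All.++⁺ (All.concat⁺ (All.tabulate⁺ spokes-at-coloured))
      (All.++⁺ (All.concat⁺ (All.tabulate⁺ λ e → All.concat⁺ (All.tabulate⁺ (copy-coloured e))))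
               (All.concat⁺ (All.tabulate⁺ λ u → All.concat⁺ (All.tabulate⁺ (pair-coloured u))))))

  completion-colourable : PackingColourable P (3 + k) → Colourable completion (3 + k)
  completion-colourable (c , c-ok) = colour c c-ok ∘ from vertices↔ , All.map⁺ (All.map
    (λ {p} ¬mono mono → ¬mono (monochromatic-transfer _ (colour c c-ok)
      (λ u v → subst₂ (λ x y → colour c c-ok x ≡ colour c c-ok y) (strictlyInverseʳ vertices↔ u) (strictlyInverseʳ vertices↔ v))
      p mono))
    (all-coloured c c-ok))

  -- The vertices (u , 0) carry a full copy of the packing.
  completion-reflects-colouring : ∀ {j} → Colourable completion j → PackingColourable P j
  completion-reflects-colouring {j} (g , g-ok) = c ∘ copy-vertex 0F , ok
    where
    c : Vertex → Fin j
    c = g ∘ to vertices↔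

    copies-ok : All (λ p → ¬ Monochromatic c p) copies-list
    copies-ok = All.++⁻ˡ copies-list (All.++⁻ʳ spokes-list (All.++⁻ʳ core-list (All.map⁻ g-ok)))

    ok : IsPackingColouring P (c ∘ copy-vertex 0F)
    ok e with ¬mono ∷ [] ← All.tabulate⁻ {f = copy e} (All.concat⁻
      (All.tabulate⁻ {f = λ e → concat (tabulate (copy e))} (All.concat⁻ copies-ok) e)) 0F = ¬mono

-- Padding and the orders obtained.

module _ {m s : ℕ} (P : Packing (Fin m) (Fin s)) (p : ℕ) where

  -- Isolated vertices leave colourability unchanged, and each adds three to the order of the
  -- completion.
  pad : Packing (Fin (m + p)) (Fin s)
  pad = map-packing (_↑ˡ p) (↑ˡ-injective p _ _) id id P

  pad-colourable : ∀ {k} → PackingColourable P (suc k) → PackingColourable pad (suc k)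
  pad-colourable {k} (c , c-ok) = c′ , λ e mono →
    c-ok e (monochromatic-transfer _ c (λ u v eq → trans (sym (c′-old u)) (trans eq (c′-old v))) (paths P e) mono)
    where
    c′ : Fin (m + p) → Fin (suc k)
    -- The added vertices lie on no path, so any default colour works.
    c′ = [ c , (λ _ → zero) ] ∘ splitAt m

    c′-old : ∀ u → c′ (u ↑ˡ p) ≡ c u
    c′-old u = cong [ c , (λ _ → zero) ] (splitAt-↑ˡ m u p)

  pad-reflects-colouring : ∀ {k} → PackingColourable pad k → PackingColourable P k
  pad-reflects-colouring (c , c-ok) = c ∘ (_↑ˡ p) , c-ok

ChromaticSystems : ℕ → Set
ChromaticSystems k = Σ[ m ∈ ℕ ] (∀ {h} → Hub h → ∀ p → Σ[ S ∈ P₄System (h + (m + p) * 3) ] Chromatic S k)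

chromatic-systems : ∀ k → ChromaticPacking (2 + k) → ChromaticSystems (3 + k)
chromatic-systems k (m , s , P , col , ¬col) = m , λ H p →
  let open Completion {k = k} H (pad P p) in
  completion , completion-colourable (pad-colourable P p col) ,
  ¬col ∘ pad-reflects-colouring P p ∘ completion-reflects-colouring

-- Admissible orders modulo 3.

-- The product is 2 modulo 3, hence not divisible by 6.
residue-2-inadmissible : ∀ q → ((2 + q * 3) * (1 + q * 3)) % 6 ≢ 0
residue-2-inadmissible q eq = from-no (3 ∣? 2)
  (∣m+n∣m⇒∣n (subst (3 ∣_) (expand q) (∣-trans (from-yes (3 ∣? 6)) (m%n≡0⇒n∣m _ 6 eq))) (n∣m*n (3 * q + 3 * q * q)))
  where
  expand : ∀ q → (2 + q * 3) * (1 + q * 3) ≡ (3 * q + 3 * q * q) * 3 + 2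
  expand = solve-∀

admissible-residue : ∀ n → Admissible n → n ≢ 1 → ∃[ q ] (n ≡ q * 3 ⊎ n ≡ 1 + q * 3)
admissible-residue n (inj₁ n≡1)      n≢1 = ⊥-elim (n≢1 n≡1)
admissible-residue n (inj₂ (_ , eq)) _   = n / 3 , by-residue (n % 3) (m%n<n n 3) (m≡m%n+[m/n]*n n 3)
  where
  by-residue : ∀ ρ → ρ ℕ.< 3 → n ≡ ρ + n / 3 * 3 → n ≡ n / 3 * 3 ⊎ n ≡ 1 + n / 3 * 3
  by-residue 0 _ n≡ = inj₁ n≡
  by-residue 1 _ n≡ = inj₂ n≡
  by-residue 2 _ n≡ = ⊥-elim (residue-2-inadmissible (n / 3) (subst (λ n → (n * (n ∸ 1)) % 6 ≡ 0) n≡ eq))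
  by-residue (suc (suc (suc _))) (s≤s (s≤s (s≤s ()))) _

systems-of-admissible-order : ∀ {k} → ChromaticSystems k →
  Σ[ nₖ ∈ ℕ ] (∀ n → Admissible n → n ≥ nₖ → Σ[ S ∈ P₄System n ] Chromatic S k)
systems-of-admissible-order {k} (m , build) =
  -- The order with a hub of six and no padding; being above 1, it also excludes the admissible
  -- order 1.
  (2 + m) * 3 , λ n adm n≥ → of-order n≥ (admissible-residue n adm λ { refl → contradiction n≥ λ { (s≤s ()) } })
  where
  of-order : ∀ {n} → n ≥ (2 + m) * 3 → ∃[ q ] (n ≡ q * 3 ⊎ n ≡ 1 + q * 3) →
    Σ[ S ∈ P₄System n ] Chromatic S k
  -- By computation `6 + (m + p) * 3` is `(2 + m + p) * 3`: the six hub vertices count as two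
  -- triples.
  of-order n≥ (q , inj₁ refl) = subst (λ q → Σ[ S ∈ P₄System (q * 3) ] Chromatic S k)
    (ℕ.m+[n∸m]≡n (ℕ.*-cancelʳ-≤ (2 + m) q 3 n≥)) (build hub₆ (q ∸ (2 + m)))
  of-order n≥ (q , inj₂ refl) = subst (λ q → Σ[ S ∈ P₄System (1 + q * 3) ] Chromatic S k)
    (ℕ.m+[n∸m]≡n (ℕ.*-cancelʳ-≤ m q 3 (ℕ.s≤s⁻¹ (ℕ.≤-trans (ℕ.m≤n+m (suc (m * 3)) 5) n≥)))) (build hub₁ (q ∸ m))

theorem3p12 : ∀ (k : ℕ) → k ≥ 3 →
    Σ[ nₖ ∈ ℕ ] (∀ (n : ℕ) → Admissible n → n ≥ nₖ →
    Σ[ S ∈ P₄System n ] Chromatic S k)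
theorem3p12 (suc (suc (suc k))) (s≤s (s≤s (s≤s z≤n))) =
  -- `ChromaticPacking` is indexed by the number of colours that fail, one below the chromatic
  -- number `3 + k`.
  systems-of-admissible-order (chromatic-systems k (chromatic-packing (2 + k)))
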